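{- Suppose that $v, w \in S_n$ are fully commutative permutations with $w = v s_i$, $\ell(w) = \ell(v) + 1$, and $i \in \operatorname{supp}(v)$. Suppose moreover that $P(v) \neq P(w)$. Then $w$ is a crowded permutation.
   Context: $s_i$ is the simple reflection swapping $i$ and $i+1$ (so $vs_i$ swaps the entries of $v$ in positions $i,i+1$); $\ell$ is Coxeter length (number of inversions). The support $\operatorname{supp}(v)$ is the set of letters appearing in reduced words of $v$; equivalently, $i \in \operatorname{supp}(v)$ iff $\{v(1),\dots,v(i)\} \neq \{1,\dots,i\}$. A permutation is fully commutative iff it avoids $321$. $P(w)$ is the RSK insertion tableau of $w$ (at most two rows for fully commutative $w$), and $\mathrm{Row}_2(T)$ is the set of entries in the second row of a tableau $T$. A set $L$ of integers is uncrowded if for all integers $x>0$ and $y$ we have $|[y,y+2x]\cap L| \le x+1$, and crowded otherwise. A fully commutative permutation $w$ is crowded (resp. uncrowded) if $\mathrm{Row}_2(P(w))$ is a crowded (resp. uncrowded) set. -}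

module Defs where

open import Data.Nat using (ℕ; zero; suc; _+_; _*_; _<_; _>_; _<?_; _≤_)
open import Data.Nat.Properties using (<-strictTotalOrder)
open import Data.Integer as ℤ using (ℤ; +_)
open import Data.List using (List; []; _∷_; _++_; [_]; length; filter; map; upTo; take; foldl)
open import Data.List.Membership.Propositional using (_∈_)
open import Data.List.Relation.Binary.Permutation.Propositional using (_↭_)
open import Data.List.Relation.Binary.Sublist.Propositional using (_⊆_)
open import Data.Maybe using (Maybe; just; nothing)
open import Data.Product using (_×_; _,_; ∃-syntax)
open import Relation.Nullary using (¬_; yes; no)
open import Relation.Nullary.Decidable using (_×-dec_)
open import Function.Bundles using (_⇔_)

-- Permutations of S_n in one-line notation: w = [w(1), ..., w(n)],
-- a list which is a rearrangement of [1, ..., n].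
oneToN : ℕ → List ℕ
oneToN n = map suc (upTo n)

IsPerm : ℕ → List ℕ → Set
IsPerm n w = w ↭ oneToN n

-- v s_i : swap the entries of v in positions i, i+1 (1-based positions).
swapAt : ℕ → List ℕ → List ℕ
swapAt zero xs = xs
swapAt (suc zero) (a ∷ b ∷ xs) = b ∷ a ∷ xs
swapAt (suc zero) xs = xs
swapAt (suc (suc k)) [] = []
swapAt (suc (suc k)) (a ∷ xs) = a ∷ swapAt (suc k) xs

-- Coxeter length = number of inversions.
inv : List ℕ → ℕ
inv [] = 0
inv (x ∷ xs) = length (filter (_<? x) xs) + inv xs

InSupp : ℕ → List ℕ → Set
InSupp i v = ¬ (∀ x → (x ∈ take i v) ⇔ (x ∈ oneToN i))

-- Fully commutative = 321-avoiding: no subsequence c b a with c > b > a.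
FullyCommutative : List ℕ → Set
FullyCommutative w = ¬ (∃[ c ] ∃[ b ] ∃[ a ] ((c ∷ b ∷ a ∷ []) ⊆ w × c > b × b > a))

Tableau : Set
Tableau = List (List ℕ)

bumpRow : ℕ → List ℕ → Maybe ℕ × List ℕ
bumpRow x [] = nothing , [ x ]
bumpRow x (y ∷ ys) with x <? y
... | yes _ = just y , x ∷ ys
... | no _ with bumpRow x ys
...   | (m , ys') = m , y ∷ ys'

insertT : ℕ → Tableau → Tableau
insertT x [] = [ [ x ] ]
insertT x (r ∷ rs) with bumpRow x r
... | (nothing , r') = r' ∷ rs
... | (just y , r') = r' ∷ insertT y rs

P : List ℕ → Tableau
P w = foldl (λ T x → insertT x T) [] w

Row2 : Tableau → List ℕ
Row2 (_ ∷ r ∷ _) = r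
Row2 _ = []

-- |[y, y+2x] ∩ L| for a list L of distinct naturals.
countIn : ℤ → ℕ → List ℕ → ℕ
countIn y x L =
  length (filter (λ l → (y ℤ.≤? + l) ×-dec (+ l ℤ.≤? (y ℤ.+ + (2 * x)))) L)

Uncrowded : List ℕ → Set
Uncrowded L = ∀ (x : ℕ) (y : ℤ) → 0 < x → countIn y x L ≤ x + 1

Crowded : List ℕ → Set
Crowded L = ¬ Uncrowded L

CrowdedPerm : List ℕ → Set
CrowdedPerm w = Crowded (Row2 (P w))

{-# OPTIONS --safe #-}

-- Write v = α a b β and w = α b a β with a < b, and let R, B be the rows of P(α); in a 321-avoiding
-- word every entry bumped from the first row is appended to the second.  Since i ∈ supp(v), some
-- c ∈ α and d ∈ β satisfy a < d < c < b.  If R had an entry above a, then a would bump the same entry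
-- before and after b, giving P(v) = P(w); so R < a, c lies in B, and the two tableaux now differ only
-- in that b is in the first row for v and in the second for w.  While β is inserted they keep
-- differing by a single entry s.  An entry x > s acts alike on both; an entry x < s bumps s in v and
-- the entry following s in w, which becomes the new s (without such an entry the tableaux would
-- merge).  So if X is the set of entries x of the latter kind, the second row of P(w) acquires ∣X∣
-- entries in (b, s], while in the first row only those of X lie in (a, s].  As d ∈ X, a window of
-- length 2∣X∣ ending at s is crowded.
module Submission where

open import Defs
open import Data.Nat using (ℕ; _+_; _≤_; _<_)
open import Data.List using (List)
open import Relation.Binary.PropositionalEquality using (_≡_; _≢_)

open import Data.Nat using (zero; suc; _*_; _∸_; _<?_; z≤n; s≤s; z<s)
open import Data.Nat.Properties
open import Data.Nat.Tactic.RingSolver using (solve-∀)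
open import Data.Integer as ℤ using (+_; _⊖_)
import Data.Integer.Properties as ℤ
open import Data.List using ([]; _∷_; _++_; [_]; _∷ʳ_; length; filter; map; upTo; take; foldl)
open import Data.List.Properties
  using (++-assoc; ++-identityʳ; length-++; length-map; length-upTo; filter-accept; filter-reject;
         foldl-++; ∷ʳ-++)
open import Data.List.Membership.Propositional using (_∈_; _∉_; find; lose)
open import Data.List.Membership.Propositional.Properties
open import Data.List.Relation.Binary.Permutation.Propositional
  using (_↭_; prep; ↭⇒↭ₛ; ↭-refl; ↭-sym; ↭-trans; ↭-swap)
import Data.List.Relation.Binary.Permutation.Propositional.Properties as Perm
import Data.List.Relation.Binary.Permutation.Setoid.Properties as PermS
open import Data.List.Relation.Binary.Sublist.Propositional
  using (_⊆_; ⊆-refl; ⊆-trans; minimum; from∈) renaming (_∷_ to _∷ˢ_)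
import Data.List.Relation.Binary.Sublist.Propositional.Properties as Sub
open import Data.List.Relation.Unary.All as All using (All; []; _∷_)
import Data.List.Relation.Unary.All.Properties as All
open import Data.List.Relation.Unary.AllPairs as AllPairs using (AllPairs; []; _∷_)
import Data.List.Relation.Unary.AllPairs.Properties as AllPairs
open import Data.List.Relation.Unary.Any using (here; there; any?; tail)
open import Data.List.Relation.Unary.Unique.Propositional using (Unique)
import Data.List.Relation.Unary.Unique.Propositional.Properties as Unique
open import Data.Empty using (⊥)
open import Data.Maybe using (just; nothing)
open import Data.Product using (_×_; _,_; proj₁; proj₂; ∃-syntax; Σ-syntax)
open import Data.Sum using (_⊎_; inj₁; inj₂)
open import Function using (_∘_; id)
open import Function.Bundles using (_⇔_; mk⇔)
open import Level using (Level)
open import Relation.Binary using (Rel; tri<; tri≈; tri>)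
open import Relation.Binary.PropositionalEquality
  using (refl; sym; trans; cong; cong₂; subst; subst₂; setoid)
open import Relation.Nullary using (¬_; yes; no; contradiction)
open import Relation.Nullary.Decidable using (_×-dec_)

private
  variable
    ℓ : Level
    a b c d n x y z : ℕ
    A B C L R p q u w xs ys : List ℕ

-- Lists without repetition, and the word 1, ..., n

AllPairs-++⁻ : {_∼_ : Rel ℕ ℓ} (xs : List ℕ) → AllPairs _∼_ (xs ++ ys) →
  AllPairs _∼_ xs × AllPairs _∼_ ys × All (λ x → All (x ∼_) ys) xs
AllPairs-++⁻ []       pys = [] , pys , []
AllPairs-++⁻ (x ∷ xs) (px ∷ pxs) with AllPairs-++⁻ xs pxs
... | pxs′ , pys , cross = All.++⁻ˡ xs px ∷ pxs′ , pys , All.++⁻ʳ xs px ∷ cross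

Unique⇒length≤ : Unique xs → (∀ {x} → x ∈ xs → x ∈ ys) → length xs ≤ length ys
Unique⇒length≤ []         _  = z≤n
Unique⇒length≤ {x ∷ xs} {ys} (x∉ ∷ xs!) sub with ∈-∃++ (sub (here refl))
... | ls , rs , refl = subst (suc (length xs) ≤_) (sym (Perm.↭-length (Perm.shift x ls rs)))
  (s≤s (Unique⇒length≤ xs! remaining))
  where
  remaining : ∀ {z} → z ∈ xs → z ∈ ls ++ rs
  remaining z∈xs with Perm.∈-resp-↭ (Perm.shift x ls rs) (sub (there z∈xs))
  ... | here refl = contradiction refl (All.lookup x∉ z∈xs)
  ... | there z∈  = z∈

Unique-resp-↭ : xs ↭ ys → Unique xs → Unique ys
Unique-resp-↭ = PermS.Unique-resp-↭ (setoid ℕ) ∘ ↭⇒↭ₛ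

Unique-prefix∌ : ∀ u → Unique (u ++ x ∷ ys) → x ∉ u
Unique-prefix∌ u u! x∈u with AllPairs-++⁻ u u!
... | _ , _ , cross = All.head (All.lookup cross x∈u) refl

∈-oneToN⁺ : 1 ≤ x → x ≤ n → x ∈ oneToN n
∈-oneToN⁺ (s≤s _) x≤n = ∈-map⁺ suc (∈-upTo⁺ x≤n)

∈-oneToN⁻ : x ∈ oneToN n → 1 ≤ x × x ≤ n
∈-oneToN⁻ x∈ with ∈-map⁻ suc x∈
... | _ , k∈ , refl = s≤s z≤n , ∈-upTo⁻ k∈

Unique-oneToN : ∀ n → Unique (oneToN n)
Unique-oneToN n = Unique.map⁺ suc-injective (Unique.upTo⁺ n)

length-oneToN : ∀ n → length (oneToN n) ≡ n
length-oneToN n = trans (length-map suc (upTo n)) (length-upTo n)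

FullyCommutative-⊆ : u ⊆ w → FullyCommutative w → FullyCommutative u
FullyCommutative-⊆ u⊆w fc (c , b , a , cba⊆u , p) = fc (c , b , a , ⊆-trans cba⊆u u⊆w , p)

FullyCommutative-prefix : ∀ u → FullyCommutative (u ++ xs) → FullyCommutative u
FullyCommutative-prefix {xs = xs} u = FullyCommutative-⊆ (Sub.++⁺ʳ xs ⊆-refl)

-- Row insertion

ins : Tableau → ℕ → Tableau
ins T x = insertT x T

-- An empty second row is not represented in a tableau, but an empty first row is: [[]] and []
-- have the same insertions.
tab : List ℕ → List ℕ → Tableau
tab R []      = [ R ]
tab R (y ∷ B) = R ∷ (y ∷ B) ∷ []

Row2-tab : ∀ R B → Row2 (tab R B) ≡ B
Row2-tab R []      = refl
Row2-tab R (_ ∷ _) = refl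

bumpRow-append : All (_≤ x) R → bumpRow x R ≡ (nothing , R ∷ʳ x)
bumpRow-append []         = refl
bumpRow-append {x} {y ∷ R} (y≤x ∷ R≤x) with x <? y
... | yes x<y = contradiction x<y (≤⇒≯ y≤x)
... | no  _ rewrite bumpRow-append R≤x = refl

bumpRow-bump : ∀ {g G} → All (_< x) L → x < g → bumpRow x (L ++ g ∷ G) ≡ (just g , L ++ x ∷ G)
bumpRow-bump {x} {[]} {g = g} [] x<g with x <? g
... | yes _  = refl
... | no x≮g = contradiction x<g x≮g
bumpRow-bump {x} {y ∷ L} {G = G} (y<x ∷ L<x) x<g with x <? y
... | yes x<y = contradiction x<y (<-asym y<x)
... | no  _ rewrite bumpRow-bump {G = G} L<x x<g = refl

insertT-append : ∀ B → All (_< x) R → insertT x (tab R B) ≡ tab (R ∷ʳ x) B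
insertT-append []      R<x rewrite bumpRow-append (All.map <⇒≤ R<x) = refl
insertT-append (_ ∷ _) R<x rewrite bumpRow-append (All.map <⇒≤ R<x) = refl

insertT-bump : ∀ {g G} → All (_< x) L → x < g → All (_≤ g) B →
  insertT x (tab (L ++ g ∷ G) B) ≡ tab (L ++ x ∷ G) (B ∷ʳ g)
insertT-bump {G = G} L<x x<g [] rewrite bumpRow-bump {G = G} L<x x<g = refl
insertT-bump {G = G} L<x x<g B≤g@(_ ∷ _)
  rewrite bumpRow-bump {G = G} L<x x<g | bumpRow-append B≤g = refl

data Bumping (x : ℕ) : List ℕ → Set where
  append : All (_< x) R → Bumping x R
  bump   : ∀ L g G → All (_< x) L → x < g → Bumping x (L ++ g ∷ G)

bumping : ∀ R → x ∉ R → Bumping x R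
bumping []      _ = append []
bumping {x} (y ∷ R) x∉ with <-cmp x y
... | tri< x<y _ _ = bump [] y R [] x<y
... | tri≈ _ x≡y _ = contradiction (here x≡y) x∉
... | tri> _ _ y<x with bumping R (x∉ ∘ there)
...   | append R<x         = append (y<x ∷ R<x)
...   | bump L g G L<x x<g = bump (y ∷ L) g G (y<x ∷ L<x) x<g

-- Starting from `[ [] ]` makes the empty word fit the form `tab R B` as well.
tableauOf : List ℕ → Tableau
tableauOf = foldl ins [ [] ]

-- A descent from y to t in u such that any later entry below z is also below t, and so completes a
-- 321 pattern.
Guard : List ℕ → ℕ → ℕ → Set
Guard u y z = ∃[ t ] z ≤ t × t < y × (y ∷ t ∷ []) ⊆ u

guard-snoc : Guard u y z → Guard (u ∷ʳ x) y z
guard-snoc (t , z≤t , t<y , yt⊆u) = t , z≤t , t<y , Sub.++⁺ʳ _ yt⊆u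

record Rows (u R B : List ℕ) : Set where
  field
    tableau : tableauOf u ≡ tab R B
    sorted  : AllPairs _<_ R
    content : R ++ B ↭ u
    -- Were z bumped after y, its bumper would complete a 321 pattern.
    guard   : y ∈ B → z ∈ R → z < y → Guard u y z

open Rows

Rows-[] : Rows [] [] []
Rows-[] = record { tableau = refl ; sorted = [] ; content = ↭-refl ; guard = λ () }

∈-snoc⊆ : ∀ {x y} → y ∈ u → (y ∷ x ∷ []) ⊆ (u ∷ʳ x)
∈-snoc⊆ y∈u = Sub.++⁺ (from∈ y∈u) ⊆-refl

row₁⊆ : Rows u R B → x ∈ R → x ∈ u
row₁⊆ r x∈R = Perm.∈-resp-↭ (content r) (∈-++⁺ˡ x∈R)

row₂⊆ : Rows u R B → x ∈ B → x ∈ u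
row₂⊆ {R = R} r x∈B = Perm.∈-resp-↭ (content r) (∈-++⁺ʳ R x∈B)

Rows-append : Rows u R B → All (_< x) R → Rows (u ∷ʳ x) (R ∷ʳ x) B
Rows-append {u} {R} {B} {x} r R<x = record
  { tableau = trans (foldl-++ ins [ [] ] u [ x ])
      (trans (cong (insertT x) (tableau r)) (insertT-append B R<x))
  ; sorted  = AllPairs.++⁺ (sorted r) ([] ∷ []) (All.map (_∷ []) R<x)
  ; content = ↭-trans (↭-trans (Perm.++⁺ʳ B (↭-sym (Perm.∷↭∷ʳ x R)))
      (prep x (content r))) (Perm.∷↭∷ʳ x u)
  ; guard   = guard′
  }
  where
  guard′ : ∀ {y z} → y ∈ B → z ∈ R ∷ʳ x → z < y → Guard (u ∷ʳ x) y z
  guard′ y∈B z∈ z<y with ∈-++⁻ R z∈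
  ... | inj₂ (here refl) = x , ≤-refl , z<y , ∈-snoc⊆ (row₂⊆ r y∈B)
  ... | inj₁ z∈R = guard-snoc (guard r y∈B z∈R z<y)

module _ {g G} (r : Rows u (L ++ g ∷ G) B) (L<x : All (_< x) L) (x<g : x < g)
         (fc : FullyCommutative (u ∷ʳ x)) where

  -- An entry y > g of the second row has a guard t after it with x < g ≤ t < y, so y, t, x would be
  -- a 321 pattern. This is what sends bumped entries to the end of the second row.
  bumped-max : All (_≤ g) B
  bumped-max = All.tabulate λ y∈B → ≮⇒≥ λ g<y →
    let t , g≤t , t<y , yt⊆u = guard r y∈B (∈-insert L) g<y
    in fc (_ , t , x , Sub.++⁺ yt⊆u ⊆-refl , t<y , <-≤-trans x<g g≤t)

  Rows-bump : Rows (u ∷ʳ x) (L ++ x ∷ G) (B ∷ʳ g)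
  Rows-bump = record
    { tableau = trans (foldl-++ ins [ [] ] u [ x ])
        (trans (cong (insertT x) (tableau r)) (insertT-bump L<x x<g bumped-max))
    ; sorted  = sorted′
    ; content = content′
    ; guard   = guard′
    }
    where
    L↑ = proj₁ (AllPairs-++⁻ L (sorted r))
    g∷G↑ = proj₁ (proj₂ (AllPairs-++⁻ L (sorted r)))
    L<g∷G = proj₂ (proj₂ (AllPairs-++⁻ L (sorted r)))

    x<G : All (x <_) G
    x<G = All.map (<-trans x<g) (AllPairs.head g∷G↑)

    sorted′ : AllPairs _<_ (L ++ x ∷ G)
    sorted′ = AllPairs.++⁺ L↑ (x<G ∷ AllPairs.tail g∷G↑)
      (All.zipWith (λ { (l<x , _ ∷ l<G) → l<x ∷ l<G }) (L<x , L<g∷G))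

    content′ : (L ++ x ∷ G) ++ (B ∷ʳ g) ↭ u ∷ʳ x
    content′ = ↭-trans (Perm.++⁺ (Perm.shift x L G) (↭-sym (Perm.∷↭∷ʳ g B)))
      (↭-trans (prep x (↭-trans (Perm.shift g (L ++ G) B)
        (↭-trans (Perm.++⁺ʳ B (↭-sym (Perm.shift g L G))) (content r))))
        (Perm.∷↭∷ʳ x u))

    guard′ : ∀ {y z} → y ∈ B ∷ʳ g → z ∈ L ++ x ∷ G → z < y → Guard (u ∷ʳ x) y z
    guard′ {y} {z} y∈ z∈ z<y with ∈-++⁻ B y∈ | ∈-++⁻ L z∈
    -- The newcomer x serves as t: g comes from the first row, so it precedes x in the word, and z ≤
    -- x.
    ... | inj₂ (here refl) | inj₁ z∈L =
      x , <⇒≤ (All.lookup L<x z∈L) , x<g , ∈-snoc⊆ (row₁⊆ r (∈-insert L))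
    ... | inj₂ (here refl) | inj₂ (here refl) =
      x , ≤-refl , x<g , ∈-snoc⊆ (row₁⊆ r (∈-insert L))
    ... | inj₂ (here refl) | inj₂ (there z∈G) =
      contradiction z<y (<-asym (All.lookup (AllPairs.head g∷G↑) z∈G))
    ... | inj₁ y∈B | inj₂ (here refl) = x , ≤-refl , z<y , ∈-snoc⊆ (row₂⊆ r y∈B)
    ... | inj₁ y∈B | inj₁ z∈L =
      guard-snoc (guard r y∈B (∈-++⁺ˡ z∈L) z<y)
    ... | inj₁ y∈B | inj₂ (there z∈G) =
      guard-snoc (guard r y∈B (∈-++⁺ʳ L (there z∈G)) z<y)

Rows-extend : ∀ xs → Rows u R B → FullyCommutative (u ++ xs) → Unique (u ++ xs) →
  ∃[ R′ ] ∃[ B′ ] Rows (u ++ xs) R′ B′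
Rows-extend {u} [] r _ _ = _ , _ , subst (λ t → Rows t _ _) (sym (++-identityʳ u)) r
Rows-extend {u} {R} (x ∷ xs) r fc u! rewrite sym (∷ʳ-++ u x xs)
  with bumping R (Unique-prefix∌ u (subst Unique (∷ʳ-++ u x xs) u!) ∘ row₁⊆ r)
... | append R<x         = Rows-extend xs (Rows-append r R<x) fc u!
... | bump _ _ _ L<x x<g =
  Rows-extend xs (Rows-bump r L<x x<g (FullyCommutative-prefix (u ∷ʳ x) fc)) fc u!

-- Comparing the two insertion processes

-- The prefixes p of v and q of w have tableaux that differ in the place of s alone.  D collects the
-- former values of s, and X the inserted entries that made s change.
record Divergence (A C : List ℕ) (b : ℕ) (p q : List ℕ) : Set where
  field
    -- `A` and `C` are common to both tableaux from the start. `G` is the part of the first row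
    -- beyond s, and `Z` holds the entries bumped out of it.
    X D G Z : List ℕ
    s       : ℕ
    rowsᵛ   : Rows p ((A ++ X) ++ s ∷ G) ((C ++ D) ++ Z)
    rowsʷ   : Rows q ((A ++ X) ++ G) ((C ++ D) ++ s ∷ Z)
    ∣D∣≡∣X∣ : length D ≡ length X
    sorted-D∷ʳs : AllPairs _<_ (D ∷ʳ s)
    b≤D∷ʳs  : All (b ≤_) (D ∷ʳ s)
    s<Z     : All (s <_) Z

-- Either the tableaux merge or the divergence survives. The clauses on `X` serve to get one
-- particular entry below b into `X` and to keep it there.
Progress : (p q : List ℕ) (x : ℕ) → Divergence A C b p q → Set
Progress {A} {C} {b} p q x S =
  tableauOf (p ∷ʳ x) ≡ tableauOf (q ∷ʳ x) ⊎
  Σ[ S′ ∈ Divergence A C b (p ∷ʳ x) (q ∷ʳ x) ]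
    (∀ {d} → d ∈ Divergence.X S → d ∈ Divergence.X S′) × (x < b → x ∈ Divergence.X S′)

advance : (S : Divergence A C b p q) → FullyCommutative (p ∷ʳ x) → FullyCommutative (q ∷ʳ x) →
  x ∉ p → Progress p q x S
advance {A} {C} {b} {p} {q} {x} S fcᵛ fcʷ x∉p = go (<-cmp x s)
  where
  open Divergence S
  H = A ++ X

  H<s∷G = proj₂ (proj₂ (AllPairs-++⁻ H (sorted rowsᵛ)))
  s∷G↑ = proj₁ (proj₂ (AllPairs-++⁻ H (sorted rowsᵛ)))

  H<s : All (_< s) H
  H<s = All.map All.head H<s∷G

  b≤s : b ≤ s
  b≤s = proj₂ (All.∷ʳ⁻ b≤D∷ʳs)

  past-s : s < x → Bumping x G → Progress p q x S
  past-s s<x (append G<x) = inj₂ (record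
    { X = X ; D = D ; G = G ∷ʳ x ; Z = Z ; s = s
    ; rowsᵛ = subst (λ R → Rows (p ∷ʳ x) R _) (++-assoc H (s ∷ G) [ x ])
        (Rows-append rowsᵛ (All.++⁺ H<x (s<x ∷ G<x)))
    ; rowsʷ = subst (λ R → Rows (q ∷ʳ x) R _) (++-assoc H G [ x ])
        (Rows-append rowsʷ (All.++⁺ H<x G<x))
    ; ∣D∣≡∣X∣ = ∣D∣≡∣X∣ ; sorted-D∷ʳs = sorted-D∷ʳs ; b≤D∷ʳs = b≤D∷ʳs ; s<Z = s<Z
    } , id , λ x<b → contradiction x<b (≤⇒≯ (≤-trans b≤s (<⇒≤ s<x))))
    where
    H<x : All (_< x) H
    H<x = All.map (λ l<s → <-trans l<s s<x) H<s
  past-s s<x (bump G₁ g G₂ G₁<x x<g) = inj₂ (record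
    { X = X ; D = D ; G = G₁ ++ x ∷ G₂ ; Z = Z ∷ʳ g ; s = s
    ; rowsᵛ = subst₂ (Rows (p ∷ʳ x)) (++-assoc H (s ∷ G₁) (x ∷ G₂)) (++-assoc (C ++ D) Z [ g ])
        (Rows-bump (subst (λ R → Rows p R _) (sym (++-assoc H (s ∷ G₁) (g ∷ G₂))) rowsᵛ)
          (All.++⁺ H<x (s<x ∷ G₁<x)) x<g fcᵛ)
    ; rowsʷ = subst₂ (Rows (q ∷ʳ x)) (++-assoc H G₁ (x ∷ G₂)) (++-assoc (C ++ D) (s ∷ Z) [ g ])
        (Rows-bump (subst (λ R → Rows q R _) (sym (++-assoc H G₁ (g ∷ G₂))) rowsʷ)
          (All.++⁺ H<x G₁<x) x<g fcʷ)
    ; ∣D∣≡∣X∣ = ∣D∣≡∣X∣ ; sorted-D∷ʳs = sorted-D∷ʳs ; b≤D∷ʳs = b≤D∷ʳs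
    ; s<Z = All.++⁺ s<Z (<-trans s<x x<g ∷ [])
    } , id , λ x<b → contradiction x<b (≤⇒≯ (≤-trans b≤s (<⇒≤ s<x))))
    where
    H<x : All (_< x) H
    H<x = All.map (λ l<s → <-trans l<s s<x) H<s

  at-s : x < s → All (_< x) H → ∀ G Z → AllPairs _<_ (s ∷ G) → All (s <_) Z →
    Rows p (H ++ s ∷ G) ((C ++ D) ++ Z) → Rows q (H ++ G) ((C ++ D) ++ s ∷ Z) → Progress p q x S
  -- A larger z already in the second row prevents s from being bumped in v.
  at-s x<s H<x G (z ∷ Z) _ (s<z ∷ _) rᵛ rʷ =
    contradiction (All.lookup (bumped-max rᵛ H<x x<s fcᵛ) (∈-insert (C ++ D))) (<⇒≱ s<z)
  -- With nothing after s, v bumps s and w appends x: both end with x last in the first row and s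
  -- last in the second.
  at-s x<s H<x [] [] _ _ rᵛ rʷ = inj₁ (trans
    (tableau (Rows-bump rᵛ H<x x<s fcᵛ))
    (trans (cong₂ tab (cong (_∷ʳ x) (sym (++-identityʳ H))) (cong (_∷ʳ s) (++-identityʳ (C ++ D))))
      (sym (tableau (Rows-append rʷ (All.++⁺ H<x []))))))
  -- x bumps s in v and g in w. Now s is in both second rows and g only in that of w, so s joins `D`
  -- and g takes over its role.
  at-s x<s H<x (g ∷ G) [] ((s<g ∷ s<G) ∷ g<G ∷ G↑) _ rᵛ rʷ = inj₂ (record
    { X = X ∷ʳ x ; D = D ∷ʳ s ; G = G ; Z = [] ; s = g
    ; rowsᵛ = subst₂ (Rows (p ∷ʳ x)) (row₁ (g ∷ G))
        (trans (cong (_∷ʳ s) (++-identityʳ (C ++ D)))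
          (trans (++-assoc C D [ s ]) (sym (++-identityʳ (C ++ D ∷ʳ s)))))
        (Rows-bump rᵛ H<x x<s fcᵛ)
    ; rowsʷ = subst₂ (Rows (q ∷ʳ x)) (row₁ G) (cong (_∷ʳ g) (++-assoc C D [ s ]))
        (Rows-bump rʷ H<x (<-trans x<s s<g) fcʷ)
    ; ∣D∣≡∣X∣ = trans (length-++ D) (trans (cong (_+ 1) ∣D∣≡∣X∣) (sym (length-++ X)))
    ; sorted-D∷ʳs = AllPairs.++⁺ sorted-D∷ʳs ([] ∷ []) (All.map (_∷ [])
        (All.∷ʳ⁺ (All.map (λ { (y<s ∷ []) → <-trans y<s s<g })
          (proj₂ (proj₂ (AllPairs-++⁻ D sorted-D∷ʳs)))) s<g))
    ; b≤D∷ʳs = All.∷ʳ⁺ b≤D∷ʳs (≤-trans b≤s (<⇒≤ s<g))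
    ; s<Z = []
    } , ∈-++⁺ˡ , λ _ → ∈-++⁺ʳ X (here refl))
    where
    row₁ : ∀ ys → H ++ x ∷ ys ≡ (A ++ X ∷ʳ x) ++ ys
    row₁ ys = trans (sym (∷ʳ-++ H x ys)) (cong (_++ ys) (++-assoc A X [ x ]))

  -- The second row of w already holds s, so x cannot bump anything smaller than s there.
  before-s : x < s → ∀ L → All (_< s) L → Bumping x L → Rows q (L ++ G) ((C ++ D) ++ s ∷ Z) →
    All (_< x) L
  before-s x<s L _ (append L<x) _ = L<x
  before-s x<s _ L<s (bump L₁ g L₂ L₁<x x<g) rʷ = contradiction
    (All.lookup (bumped-max (subst (λ R → Rows q R _) (++-assoc L₁ (g ∷ L₂) G) rʷ) L₁<x x<g fcʷ)
      (∈-insert (C ++ D)))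
    (<⇒≱ (All.head (All.++⁻ʳ L₁ L<s)))

  go : _ → Progress p q x S
  go (tri< x<s _ _) = at-s x<s
    (before-s x<s H H<s (bumping H (x∉p ∘ row₁⊆ rowsᵛ ∘ ∈-++⁺ˡ)) rowsʷ) G Z s∷G↑ s<Z rowsᵛ rowsʷ
  go (tri≈ _ refl _) = contradiction (row₁⊆ rowsᵛ (∈-insert H)) x∉p
  go (tri> _ _ s<x) = past-s s<x (bumping G (x∉p ∘ row₁⊆ rowsᵛ ∘ ∈-++⁺ʳ H ∘ there))

-- Equal tableaux stay equal under further insertions, so distinct final tableaux exclude merging at
-- every step. The alternative for d is the induction invariant: d passes from the pending letters
-- into `X`.
Divergence-extend : ∀ {d} xs (S : Divergence A C b p q) →
  FullyCommutative (p ++ xs) → FullyCommutative (q ++ xs) → Unique (p ++ xs) →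
  tableauOf (p ++ xs) ≢ tableauOf (q ++ xs) → d < b → d ∈ Divergence.X S ⊎ d ∈ xs →
  Σ[ S′ ∈ Divergence A C b (p ++ xs) (q ++ xs) ] d ∈ Divergence.X S′
Divergence-extend {A} {C} {b} {p} {q} {d} [] S _ _ _ _ _ (inj₁ d∈X) =
  subst₂ (λ p q → Σ[ S′ ∈ Divergence A C b p q ] d ∈ Divergence.X S′)
    (sym (++-identityʳ p)) (sym (++-identityʳ q)) (S , d∈X)
Divergence-extend {A} {C} {b} {p} {q} {d} (x ∷ xs) S fcᵛ fcʷ p! P≢ d<b d∈
  rewrite sym (∷ʳ-++ p x xs) | sym (∷ʳ-++ q x xs)
  with advance S (FullyCommutative-prefix (p ∷ʳ x) fcᵛ) (FullyCommutative-prefix (q ∷ʳ x) fcʷ)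
         (Unique-prefix∌ p (subst Unique (∷ʳ-++ p x xs) p!))
... | inj₁ eq = contradiction
  (trans (foldl-++ ins [ [] ] (p ∷ʳ x) xs)
    (trans (cong (λ T → foldl ins T xs) eq) (sym (foldl-++ ins [ [] ] (q ∷ʳ x) xs)))) P≢
... | inj₂ (S′ , keep , new) = Divergence-extend xs S′ fcᵛ fcʷ p! P≢ d<b (track d∈)
  where
  track : d ∈ Divergence.X S ⊎ d ∈ x ∷ xs → d ∈ Divergence.X S′ ⊎ d ∈ xs
  track (inj₁ d∈X)         = inj₁ (keep d∈X)
  track (inj₂ (here refl)) = inj₁ (new d<b)
  track (inj₂ (there d∈))  = inj₂ d∈

diverge : Rows u R B → a ∉ u → a < b → All (_< b) u →
  FullyCommutative ((u ∷ʳ a) ∷ʳ b) → FullyCommutative ((u ∷ʳ b) ∷ʳ a) →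
  tableauOf ((u ∷ʳ a) ∷ʳ b) ≡ tableauOf ((u ∷ʳ b) ∷ʳ a) ⊎
  All (_< a) R × Divergence (R ∷ʳ a) B b ((u ∷ʳ a) ∷ʳ b) ((u ∷ʳ b) ∷ʳ a)
diverge {u} {R} {B} {a} {b} r a∉u a<b u<b fcᵛ fcʷ with bumping R (a∉u ∘ row₁⊆ r)
-- For v both a and b are appended, while for w the later a bumps b; so the difference starts with s
-- = b.
... | append R<a = inj₂ (R<a , record
  { X = [] ; D = [] ; G = [] ; Z = [] ; s = b
  ; rowsᵛ = subst₂ (Rows _) (cong (_∷ʳ b) (sym (++-identityʳ (R ∷ʳ a))))
      (sym (trans (++-identityʳ (B ++ [])) (++-identityʳ B)))
      (Rows-append (Rows-append r R<a) (All.∷ʳ⁺ (All.map (λ y<a → <-trans y<a a<b) R<a) a<b))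
  ; rowsʷ = subst₂ (Rows _) (sym (trans (++-identityʳ ((R ∷ʳ a) ++ [])) (++-identityʳ (R ∷ʳ a))))
      (cong (_∷ʳ b) (sym (++-identityʳ B)))
      (Rows-bump (Rows-append r (All.map (λ y<a → <-trans y<a a<b) R<a)) R<a a<b fcʷ)
  ; ∣D∣≡∣X∣ = refl
  ; sorted-D∷ʳs = [] ∷ []
  ; b≤D∷ʳs = ≤-refl ∷ []
  ; s<Z = []
  })
-- b exceeds the whole prefix, so in either order it ends the first row, past the entry g that a
-- bumps.
... | bump L g G L<a a<g = inj₁ (trans
  (tableau (Rows-append rᵛ (All.tabulate (All.lookup (All.∷ʳ⁺ u<b a<b) ∘ row₁⊆ rᵛ))))
  (trans (cong (λ R → tab R (B ∷ʳ g)) (++-assoc L (a ∷ G) [ b ]))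
    (sym (tableau (Rows-bump
      (subst (λ R → Rows _ R _) (++-assoc L (g ∷ G) [ b ])
        (Rows-append r (All.tabulate (All.lookup u<b ∘ row₁⊆ r)))) L<a a<g fcʷ)))))
  where
  rᵛ : Rows (u ∷ʳ a) (L ++ a ∷ G) (B ∷ʳ g)
  rᵛ = Rows-bump r L<a a<g (FullyCommutative-prefix (u ∷ʳ a) fcᵛ)

-- A crowded window

-- With m = ∣X∣, the window [s - 2m, s] contains at least m + 2 entries of the second row: either
-- it starts above the least element x₀ of X, and then it meets the first row only in X ∖ {x₀}, or
-- it contains c, the m elements of D, and s.
divergence⇒crowded : (S : Divergence A C b p q) → let open Divergence S in q ↭ oneToN n →
  d ∈ X → c ∈ C → d < c → c < b → Crowded ((C ++ D) ++ s ∷ Z)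
divergence⇒crowded {A} {C} {b} {p} {q} {n} {d} {c} S q↭ d∈X c∈C d<c c<b uncrowded =
  go X refl d∈X
  where
  open Divergence S
  row₂ = (C ++ D) ++ s ∷ Z

  s<G : All (s <_) G
  s<G = AllPairs.head (proj₁ (proj₂ (AllPairs-++⁻ (A ++ X) (sorted rowsᵛ))))

  AX↑ : AllPairs _<_ (A ++ X)
  AX↑ = proj₁ (AllPairs-++⁻ (A ++ X) (sorted rowsᵛ))

  D<s : All (_< s) D
  D<s = All.map All.head (proj₂ (proj₂ (AllPairs-++⁻ D sorted-D∷ʳs)))

  c<s : c < s
  c<s = <-≤-trans c<b (proj₂ (All.∷ʳ⁻ b≤D∷ʳs))

  s≤n : s ≤ n
  s≤n = proj₂ (∈-oneToN⁻ (Perm.∈-resp-↭ q↭ (row₂⊆ rowsʷ (∈-insert (C ++ D)))))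

  inRow₂ : ∀ {k} → k ∈ c ∷ D ∷ʳ s → k ∈ row₂
  inRow₂ (here refl) = ∈-++⁺ˡ (∈-++⁺ˡ c∈C)
  inRow₂ (there k∈) with ∈-++⁻ D k∈
  ... | inj₁ k∈D         = ∈-++⁺ˡ (∈-++⁺ʳ C k∈D)
  ... | inj₂ (here refl) = ∈-insert (C ++ D)

  -- `X` is a field of `S`, so it is split through an equation. It is nonempty because of d, and its
  -- head is its least entry because the first row is sorted.
  go : ∀ X₁ → X ≡ X₁ → d ∈ X₁ → ⊥
  go (x₀ ∷ X′) X≡ d∈ = <⇒≱ (≤-reflexive (sym (+-suc m 1))) (≤-trans many (uncrowded m y₀ z<s))
    where
    m = suc (length X′)
    -- The subtraction is in the integers, since 2m may exceed s.
    y₀ = s ⊖ (2 * m)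
    inside? = λ l → (y₀ ℤ.≤? + l) ×-dec (+ l ℤ.≤? (y₀ ℤ.+ + (2 * m)))
    window = filter inside? row₂

    x₀<X′ : All (x₀ <_) X′
    x₀<X′ = AllPairs.head (proj₁ (proj₂ (AllPairs-++⁻ A (subst (λ X → AllPairs _<_ (A ++ X)) X≡ AX↑))))

    A<x₀ : All (_< x₀) A
    A<x₀ = All.map All.head
      (proj₂ (proj₂ (AllPairs-++⁻ A (subst (λ X → AllPairs _<_ (A ++ X)) X≡ AX↑))))

    x₀≤ : ∀ {z} → z ∈ x₀ ∷ X′ → x₀ ≤ z
    x₀≤ (here refl) = ≤-refl
    x₀≤ (there z∈)  = <⇒≤ (All.lookup x₀<X′ z∈)

    x₀<c : x₀ < c
    x₀<c = ≤-<-trans (x₀≤ d∈) d<c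

    [a+k]⊖a : ∀ a k → (a + k) ⊖ a ≡ + k
    [a+k]⊖a a k = trans (cong ((a + k) ⊖_) (sym (+-identityʳ a))) (ℤ.+-cancelˡ-⊖ a k 0)

    y₀+2m≡s : y₀ ℤ.+ + (2 * m) ≡ + s
    y₀+2m≡s = trans (ℤ.distribˡ-⊖-+-pos (2 * m) s (2 * m))
      (trans (cong (_⊖ (2 * m)) (+-comm s (2 * m))) ([a+k]⊖a (2 * m) s))

    ∈-window : ∀ {k} → k ∈ row₂ → s ≤ 2 * m + k → k ≤ s → k ∈ window
    ∈-window {k} k∈ s≤ k≤s = ∈-filter⁺ inside? k∈
      ( subst (y₀ ℤ.≤_) ([a+k]⊖a (2 * m) k) (ℤ.⊖-monoˡ-≤ (2 * m) s≤)
      , subst (+ k ℤ.≤_) (sym y₀+2m≡s) (ℤ.+≤+ k≤s))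

    module Above (x₀< : 2 * m + x₀ < s) where
      2m≤s : 2 * m ≤ s
      2m≤s = ≤-trans (m≤m+n (2 * m) x₀) (<⇒≤ x₀<)

      -- As 2m ≤ s, truncated subtraction is exact here, and these are the 2m + 1 integers from s -
      -- 2m to s.
      interval = map (λ j → s ∸ 2 * m + j) (upTo (suc (2 * m)))

      -- Since 1 ≤ k ≤ n, k lies in one of the rows of w. In the first row, `A` is below x₀ < k and
      -- `G` is above s ≥ k, which leaves `X′`.
      split : ∀ {k} → k ∈ interval → k ∈ X′ ++ window
      split k∈ with ∈-map⁻ (λ j → s ∸ 2 * m + j) k∈
      ... | j , j∈ , refl = place (∈-++⁻ ((A ++ X) ++ G)
          (Perm.∈-resp-↭ (↭-sym (content rowsʷ))
            (Perm.∈-resp-↭ (↭-sym q↭) (∈-oneToN⁺ (≤-trans (s≤s z≤n) x₀<k) (≤-trans k≤s s≤n)))))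
        where
        k = s ∸ 2 * m + j

        k≤s : k ≤ s
        k≤s = ≤-trans (+-monoʳ-≤ (s ∸ 2 * m) (≤-pred (∈-upTo⁻ j∈))) (≤-reflexive (m∸n+n≡m 2m≤s))

        x₀<k : x₀ < k
        x₀<k = ≤-trans
          (m+n≤o⇒m≤o∸n (suc x₀) (subst (λ k → suc k ≤ s) (+-comm (2 * m) x₀) x₀<)) (m≤m+n _ j)

        place₁ : k ∈ A ⊎ k ∈ x₀ ∷ X′ → k ∈ X′
        place₁ (inj₁ k∈A)          = contradiction (All.lookup A<x₀ k∈A) (<-asym x₀<k)
        place₁ (inj₂ (here k≡x₀))  = contradiction (sym k≡x₀) (<⇒≢ x₀<k)
        place₁ (inj₂ (there k∈X′)) = k∈X′

        place : k ∈ (A ++ X) ++ G ⊎ k ∈ row₂ → k ∈ X′ ++ window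
        place (inj₂ k∈row₂) = ∈-++⁺ʳ X′ (∈-window k∈row₂
          (≤-trans (≤-reflexive (sym (m+[n∸m]≡n 2m≤s))) (+-monoʳ-≤ (2 * m) (m≤m+n _ j))) k≤s)
        place (inj₁ k∈row₁) with ∈-++⁻ (A ++ X) k∈row₁
        ... | inj₁ k∈AX = ∈-++⁺ˡ (place₁ (∈-++⁻ A (subst (λ X → k ∈ A ++ X) X≡ k∈AX)))
        ... | inj₂ k∈G  = contradiction (All.lookup s<G k∈G) (≤⇒≯ k≤s)

      -- Of the 2m + 1 integers at most m - 1, the length of `X′`, miss the second row.
      count : m + 2 ≤ length window
      count = +-cancelˡ-≤ (length X′) (m + 2) (length window) (begin
        length X′ + (m + 2)        ≡⟨ arith (length X′) ⟩
        suc (2 * m)                ≡⟨ length-upTo (suc (2 * m)) ⟨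
        length (upTo (suc (2 * m))) ≡⟨ length-map _ (upTo (suc (2 * m))) ⟨
        length interval            ≤⟨ Unique⇒length≤ interval! split ⟩
        length (X′ ++ window)      ≡⟨ length-++ X′ ⟩
        length X′ + length window  ∎)
        where
        open ≤-Reasoning
        interval! : Unique interval
        interval! = Unique.map⁺ (+-cancelˡ-≡ (s ∸ 2 * m) _ _) (Unique.upTo⁺ (suc (2 * m)))
        arith : ∀ k → k + (suc k + 2) ≡ suc (2 * suc k)
        arith = solve-∀

    module Below (s≤ : s ≤ 2 * m + x₀) where
      -- The lower bound comes from x₀ ≤ d < c < b, where b in turn bounds `D` and s from below.
      bounds : ∀ {k} → k ∈ c ∷ D ∷ʳ s → x₀ ≤ k × k ≤ s
      bounds (here refl) = <⇒≤ x₀<c , <⇒≤ c<s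
      bounds (there k∈)  = <⇒≤ (<-≤-trans (<-trans x₀<c c<b) (All.lookup b≤D∷ʳs k∈))
                         , All.lookup (All.∷ʳ⁺ (All.map <⇒≤ D<s) ≤-refl) k∈

      unique : Unique (c ∷ D ∷ʳ s)
      unique = All.map (λ b≤k → <⇒≢ (<-≤-trans c<b b≤k)) b≤D∷ʳs ∷ AllPairs.map <⇒≢ sorted-D∷ʳs

      count : m + 2 ≤ length window
      count = begin
        m + 2                 ≡⟨ +-suc m 1 ⟩
        suc (m + 1)           ≡⟨ cong (λ X → suc (length X + 1)) X≡ ⟨
        suc (length X + 1)    ≡⟨ cong (λ k → suc (k + 1)) ∣D∣≡∣X∣ ⟨
        suc (length D + 1)    ≡⟨ cong suc (length-++ D) ⟨
        length (c ∷ D ∷ʳ s)   ≤⟨ Unique⇒length≤ unique inWindow ⟩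
        length window         ∎
        where
        open ≤-Reasoning
        inWindow : ∀ {k} → k ∈ c ∷ D ∷ʳ s → k ∈ window
        inWindow k∈ = let x₀≤k , k≤s = bounds k∈ in
          ∈-window (inRow₂ k∈) (≤-trans s≤ (+-monoʳ-≤ (2 * m) x₀≤k)) k≤s

    many : m + 2 ≤ countIn y₀ m row₂
    many with 2 * m + x₀ <? s
    ... | yes x₀< = Above.count x₀<
    ... | no  x₀≮ = Below.count (≮⇒≥ x₀≮)

-- Support and length

-- Otherwise no entry of p exceeds an entry of q, so p consists of exactly the values 1, ...,
-- `length p`, against the support condition.
support⇒inversion : ∀ p → IsPerm n (p ++ q) → length p ≤ n →
  ¬ (∀ x → (x ∈ p) ⇔ (x ∈ oneToN (length p))) → ∃[ c ] ∃[ d ] c ∈ p × d ∈ q × d < c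
support⇒inversion {n} {q} p p++q↭ ∣p∣≤n supp with any? (λ c → any? (_<? c) q) p
... | yes c∈p with find c∈p
...   | c , c∈ , d∈q with find d∈q
...     | d , d∈ , d<c = c , d , c∈ , d∈ , d<c
support⇒inversion {n} {q} p p++q↭ ∣p∣≤n supp | no none =
  contradiction (λ x → mk⇔ into from) supp
  where
  p<q : ∀ {c d} → c ∈ p → d ∈ q → c ≤ d
  p<q c∈p d∈q = ≮⇒≥ λ d<c → none (lose c∈p (lose d∈q d<c))

  p++q! : Unique (p ++ q)
  p++q! = Unique-resp-↭ (↭-sym p++q↭) (Unique-oneToN n)

  p∩q : ∀ {x} → x ∈ p → x ∉ q
  p∩q x∈p x∈q = All.lookup (All.lookup (proj₂ (proj₂ (AllPairs-++⁻ p p++q!))) x∈p) x∈q refl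

  bounds : ∀ {x} → x ∈ p → 1 ≤ x × x ≤ n
  bounds = ∈-oneToN⁻ ∘ Perm.∈-resp-↭ p++q↭ ∘ ∈-++⁺ˡ

  locate : ∀ {x} → 1 ≤ x → x ≤ n → x ∈ p ⊎ x ∈ q
  locate 1≤x x≤n = ∈-++⁻ p (Perm.∈-resp-↭ (↭-sym p++q↭) (∈-oneToN⁺ 1≤x x≤n))

  into : ∀ {x} → x ∈ p → x ∈ oneToN (length p)
  -- All of 1, ..., x lie in p, so x is at most the length of p.
  into {x} x∈p = ∈-oneToN⁺ (proj₁ (bounds x∈p))
    (subst (_≤ length p) (length-oneToN x) (Unique⇒length≤ (Unique-oneToN x) below))
    where
    below : ∀ {k} → k ∈ oneToN x → k ∈ p
    below k∈ with ∈-oneToN⁻ k∈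
    ... | 1≤k , k≤x with locate 1≤k (≤-trans k≤x (proj₂ (bounds x∈p)))
    ...   | inj₁ k∈p = k∈p
    ...   | inj₂ k∈q = subst (_∈ p) (≤-antisym (p<q x∈p k∈q) k≤x) x∈p

  from : ∀ {x} → x ∈ oneToN (length p) → x ∈ p
  from {zero}  x∈ = contradiction (proj₁ (∈-oneToN⁻ x∈)) λ ()
  from {suc x} x∈ with ∈-oneToN⁻ x∈
  ... | 1≤x , x<∣p∣ with locate 1≤x (≤-trans x<∣p∣ ∣p∣≤n)
  ...   | inj₁ x∈p = x∈p
  -- With `suc x` in q, all of p would lie in 1, ..., x, too few values for its length.
  ...   | inj₂ x∈q = contradiction
    (subst (length p ≤_) (length-oneToN x) (Unique⇒length≤ (proj₁ (AllPairs-++⁻ p p++q!)) below))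
    (<⇒≱ x<∣p∣)
    where
    below : ∀ {k} → k ∈ p → k ∈ oneToN x
    below k∈p = ∈-oneToN⁺ (proj₁ (bounds k∈p))
      (≤-pred (≤∧≢⇒< (p<q k∈p x∈q) λ { refl → p∩q k∈p x∈q }))

-- This rules out a descent of v at position i, as w is longer than v. Letters before the pair see
-- the same letters after them, so only the pair itself changes the count.
inv-swap-≤ : b < a → ∀ u → inv (u ++ b ∷ a ∷ xs) ≤ inv (u ++ a ∷ b ∷ xs)
inv-swap-≤ {b} {a} {xs} b<a []
  rewrite filter-reject (_<? b) {xs = xs} (<-asym b<a) | filter-accept (_<? a) {xs = xs} b<a =
  ≤-trans (≤-reflexive (rearrange (length (filter (_<? b) xs)) (length (filter (_<? a) xs)) (inv xs)))
    (n≤1+n _)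
  where
  rearrange : ∀ k l m → k + (l + m) ≡ l + (k + m)
  rearrange = solve-∀
inv-swap-≤ {b} {a} {xs} b<a (x ∷ u) = +-mono-≤
  (≤-reflexive (Perm.↭-length (Perm.filter-↭ (_<? x) (Perm.++⁺ˡ u (↭-swap b a ↭-refl)))))
  (inv-swap-≤ b<a u)

-- The last two fields turn the support condition at i into one on the prefix `α ∷ʳ vᵢ` and its own
-- length.
record SwapAt (i : ℕ) (v : List ℕ) : Set where
  field
    α β     : List ℕ
    vᵢ vᵢ₊₁ : ℕ
    before  : v ≡ α ++ vᵢ ∷ vᵢ₊₁ ∷ β
    after   : swapAt i v ≡ α ++ vᵢ₊₁ ∷ vᵢ ∷ β
    take≡   : take i v ≡ α ∷ʳ vᵢ
    length≡ : length (α ∷ʳ vᵢ) ≡ i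

swapAt-split : ∀ i v → 1 ≤ i → i < length v → SwapAt i v
swapAt-split (suc zero) (a ∷ b ∷ β) _ _ = record
  { α = [] ; vᵢ = a ; vᵢ₊₁ = b ; β = β ; before = refl ; after = refl ; take≡ = refl ; length≡ = refl }
swapAt-split (suc zero) (_ ∷ []) _ (s≤s ())
swapAt-split (suc (suc k)) (x ∷ v) _ (s≤s k<) = record
  { α = x ∷ α ; vᵢ = vᵢ ; vᵢ₊₁ = vᵢ₊₁ ; β = β ; before = cong (x ∷_) before ; after = cong (x ∷_) after
  ; take≡ = cong (x ∷_) take≡ ; length≡ = cong suc length≡ }
  where open SwapAt (swapAt-split (suc k) v (s≤s z≤n) k<)

-- From the swapped letters to the theorem

P≡tableauOf : ∀ u → P (u ++ x ∷ xs) ≡ tableauOf (u ++ x ∷ xs)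
P≡tableauOf []      = refl
P≡tableauOf (_ ∷ _) = refl

snoc₂ : ∀ α (a b : ℕ) β → α ++ a ∷ b ∷ β ≡ ((α ∷ʳ a) ∷ʳ b) ++ β
snoc₂ α a b β = sym (trans (∷ʳ-++ (α ∷ʳ a) b β) (∷ʳ-++ α a (b ∷ β)))

swap⇒crowded : ∀ α β → let v = α ++ a ∷ b ∷ β ; w = α ++ b ∷ a ∷ β in
  IsPerm n v → IsPerm n w → FullyCommutative v → FullyCommutative w → a < b →
  c ∈ α ∷ʳ a → d ∈ b ∷ β → d < c → P v ≢ P w → CrowdedPerm w
swap⇒crowded {a} {b} {n} {c} {d} α β v↭ w↭ fcᵛ fcʷ a<b c∈ d∈ d<c P≢
  with Rows-extend α Rows-[] (FullyCommutative-prefix α fcᵛ)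
         (proj₁ (AllPairs-++⁻ α (Unique-resp-↭ (↭-sym v↭) (Unique-oneToN n))))
... | R , B , r = conclude (diverge r (Unique-prefix∌ α v!) a<b α<b
        (FullyCommutative-prefix ((α ∷ʳ a) ∷ʳ b) fcᵛ′) (FullyCommutative-prefix ((α ∷ʳ b) ∷ʳ a) fcʷ′))
  where
  v! : Unique (α ++ a ∷ b ∷ β)
  v! = Unique-resp-↭ (↭-sym v↭) (Unique-oneToN n)

  w! : Unique (α ++ b ∷ a ∷ β)
  w! = Unique-resp-↭ (↭-sym w↭) (Unique-oneToN n)

  fcᵛ′ : FullyCommutative (((α ∷ʳ a) ∷ʳ b) ++ β)
  fcᵛ′ = subst FullyCommutative (snoc₂ α a b β) fcᵛ

  fcʷ′ : FullyCommutative (((α ∷ʳ b) ∷ʳ a) ++ β)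
  fcʷ′ = subst FullyCommutative (snoc₂ α b a β) fcʷ

  -- In w the descent b a would extend to a 321 pattern by a larger letter before it or, for `a<β`,
  -- by a smaller letter after it.
  α<b : All (_< b) α
  α<b = All.tabulate λ x∈α → ≤∧≢⇒<
    (≮⇒≥ λ b<x → fcʷ (_ , b , a , Sub.++⁺ (from∈ x∈α) (refl ∷ˢ refl ∷ˢ minimum β) , b<x , a<b))
    (λ { refl → Unique-prefix∌ α w! x∈α })

  a<β : All (a <_) β
  a<β = All.tabulate λ x∈β → ≤∧≢⇒<
    (≮⇒≥ λ x<a → fcʷ (b , a , _ , Sub.++⁺ˡ α (refl ∷ˢ refl ∷ˢ from∈ x∈β) , a<b , x<a))
    (All.lookup (AllPairs.head (AllPairs.tail (proj₁ (proj₂ (AllPairs-++⁻ α w!))))) x∈β)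

  -- Both b and β exceed a, so a < d < c. Hence c is not a and lies in α, which gives c < b; then d
  -- < b places d in β.
  a<d : a < d
  a<d = All.lookup (a<b ∷ a<β) d∈

  a<c : a < c
  a<c = <-trans a<d d<c

  c∈α : c ∈ α
  c∈α with ∈-++⁻ α c∈
  ... | inj₁ c∈α         = c∈α
  ... | inj₂ (here refl) = contradiction a<c (<-irrefl refl)

  d<b : d < b
  d<b = <-trans d<c (All.lookup α<b c∈α)

  d∈β : d ∈ β
  d∈β = tail (<⇒≢ d<b) d∈

  tableau≢ : tableauOf (((α ∷ʳ a) ∷ʳ b) ++ β) ≢ tableauOf (((α ∷ʳ b) ∷ʳ a) ++ β)
  tableau≢ eq = P≢ (trans (P≡tableauOf α) (trans (cong tableauOf (snoc₂ α a b β))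
    (trans eq (trans (cong tableauOf (sym (snoc₂ α b a β))) (sym (P≡tableauOf α))))))

  conclude : _ → CrowdedPerm (α ++ b ∷ a ∷ β)
  conclude (inj₁ eq) = contradiction
    (trans (foldl-++ ins [ [] ] ((α ∷ʳ a) ∷ʳ b) β)
      (trans (cong (λ T → foldl ins T β) eq) (sym (foldl-++ ins [ [] ] ((α ∷ʳ b) ∷ʳ a) β)))) tableau≢
  conclude (inj₂ (R<a , S))
    with Divergence-extend β S fcᵛ′ fcʷ′ (subst Unique (snoc₂ α a b β) v!) tableau≢
           d<b (inj₂ d∈β)
  ... | S′ , d∈X = subst Crowded row₂≡
    (divergence⇒crowded S′ (subst (_↭ oneToN n) (snoc₂ α b a β) w↭) d∈X c∈B d<c (All.lookup α<b c∈α))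
    where
    open Divergence S′

    c∈B : c ∈ B
    c∈B with ∈-++⁻ R (Perm.∈-resp-↭ (↭-sym (content r)) c∈α)
    ... | inj₁ c∈R = contradiction (All.lookup R<a c∈R) (<-asym a<c)
    ... | inj₂ c∈B = c∈B

    row₂≡ : (B ++ D) ++ s ∷ Z ≡ Row2 (P (α ++ b ∷ a ∷ β))
    row₂≡ = sym (trans (cong Row2 (trans (P≡tableauOf α)
      (trans (cong tableauOf (snoc₂ α b a β)) (tableau rowsʷ)))) (Row2-tab _ ((B ++ D) ++ s ∷ Z)))

theorem4p10 : (n i : ℕ) (v w : List ℕ) →
    IsPerm n v → IsPerm n w →
    FullyCommutative v → FullyCommutative w →
    1 ≤ i → i < n →
    w ≡ swapAt i v →
    inv w ≡ inv v + 1 →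
    InSupp i v →
    P v ≢ P w →
    CrowdedPerm w
theorem4p10 n i v w v↭ w↭ fcᵛ fcʷ 1≤i i<n w≡ inv≡ supp P≢
  with swapAt-split i v 1≤i (subst (i <_) (sym (trans (Perm.↭-length v↭) (length-oneToN n))) i<n)
... | record { α = α ; β = β ; vᵢ = a ; vᵢ₊₁ = b ; before = refl
             ; after = after ; take≡ = take≡ ; length≡ = refl }
  with trans w≡ after
... | refl
  -- The support condition supplies values c > d on the two sides of the cut after position i.
  with support⇒inversion (α ∷ʳ a) (subst (_↭ oneToN n) (sym (∷ʳ-++ α a (b ∷ β))) v↭) (<⇒≤ i<n)
         (subst (λ p → ¬ (∀ x → (x ∈ p) ⇔ (x ∈ oneToN i))) take≡ supp)
... | c , d , c∈ , d∈ , d<c = swap⇒crowded α β v↭ w↭ fcᵛ fcʷ a<b c∈ d∈ d<c P≢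
  where
  a≢b : a ≢ b
  a≢b refl = Unique-prefix∌ (α ∷ʳ a)
    (subst Unique (sym (∷ʳ-++ α a (a ∷ β))) (Unique-resp-↭ (↭-sym v↭) (Unique-oneToN n)))
    (∈-insert α)

  a<b : a < b
  -- If b < a, the swap could not have raised the number of inversions.
  a<b = ≤∧≢⇒< (≮⇒≥ λ b<a →
    <⇒≱ (≤-reflexive (sym (trans inv≡ (+-comm (inv v) 1)))) (inv-swap-≤ b<a α)) a≢b
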